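{- Let $G=(V,E,c)$ be a finite undirected graph with non-negative integer edge weights and let $\hat\lambda$ be an upper bound for the value of a minimum cut of $G$. The Parallel CAPFOREST algorithm described in the context is correct, i.e. it only contracts contractible edges: in any execution with any finite number of processes, arbitrary start vertices and arbitrary interleaving, whenever a process performs an operation $\mathrm{union}(x,y)$ for an edge $e=(x,y)$, we have $\lambda(G,x,y)\ge\hat\lambda$, where $\hat\lambda$ is the value held by that process at that moment. In particular, no two vertices that end up in the same block of the shared union-find data structure $\mathcal{U}$ are separated by a cut of $G$ whose weight is strictly smaller than all values held for $\hat\lambda$ at the moments of the performed union operations.
   Context: For a graph $G=(V,E,c)$ with $c:E\to\mathbb{N}$, a cut is a partition $(A,V\setminus A)$ of $V$ into two non-empty sets; its weight is the sum of $c(e)$ over the edges $e$ with one endpoint in $A$ and one in $V\setminus A$. For vertices $s\neq t$, $\lambda(G,s,t)$ is the minimum weight of a cut with $s$ and $t$ on different sides. For a vertex $x$, $c(x)$ is its weighted degree. Parallel CAPFOREST. Several processes share a Boolean array $\mathcal{T}$ indexed by $V$ (initially all False) and a union-find data structure $\mathcal{U}$ on $V$ (initially all singletons); the graph is not modified. Accesses to $\mathcal{T}$ are not locked (a process's read of $\mathcal{T}(x)$ and its subsequent write may be interleaved with operations of other processes, so a vertex may be visited by more than one process). Each process has its own local variables: visited labels (initially all vertices unvisited), a blacklist $\mathcal{B}$ (initially empty), values $r(v)=0$ for $v\in V$, $q(e)=0$ for $e\in E$, $\alpha=0$, its own upper bound $\hat\lambda$ (initially the input value), and a max-priority queue $\mathcal{Q}$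 containing one arbitrary start vertex. Each process repeats the following while its $\mathcal{Q}$ is not empty: 1. Remove from $\mathcal{Q}$ a vertex $x$ of highest priority (ties broken arbitrarily) and mark $x$ visited. 2. If $\mathcal{T}(x)$ is True, put $x$ into $\mathcal{B}$ and go on directly to the next iteration (no other value is changed). Otherwise set $\mathcal{T}(x)\leftarrow$ True. 3. Set $\alpha\leftarrow\alpha+c(x)-2r(x)$ and $\hat\lambda\leftarrow\min(\hat\lambda,\alpha)$. 4. For each edge $e=(x,y)$ with $y\notin\mathcal{B}$ and $y$ not visited, one after another in arbitrary order: if $r(y)<\hat\lambda\le r(y)+c(e)$, perform $\mathrm{union}(x,y)$ in $\mathcal{U}$ (this marks $e$ for contraction); set $r(y)\leftarrow r(y)+c(e)$; set $q(e)\leftarrow r(y)$; set the priority of $y$ in $\mathcal{Q}$ to $\min(r(y),\hat\lambda)$ (inserting $y$ if it is not in $\mathcal{Q}$). -}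

module Defs where

open import Data.Bool.Base using (Bool; true; false; if_then_else_)
open import Data.Fin.Base using (Fin)
open import Data.Fin.Properties using (_≟_)
open import Data.Fin.Subset using (Subset; _∈_; _∉_; Nonempty; ∁; ⁅_⁆; _∪_; _-_; ⊤; ⊥)
open import Data.Fin.Subset.Properties using (_∈?_)
open import Data.Integer.Base as ℤ using (ℤ; +_; _⊓_)
open import Data.List.Base using (List; []; _∷_; _++_)
open import Data.Maybe.Base using (Maybe; just; nothing)
open import Data.Nat.Base as ℕ using (ℕ)
open import Data.Nat.Properties using (+-0-commutativeMonoid)
open import Data.Product.Base using (_×_; _,_; proj₁; proj₂; ∃-syntax)
open import Data.Sum.Base using (_⊎_)
open import Data.Vec.Functional using (Vector; updateAt)
open import Relation.Binary.PropositionalEquality.Core using (_≡_; _≢_)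
open import Relation.Nullary.Decidable.Core using (Dec; does; _×-dec_; _⊎-dec_; ¬?)
open import Relation.Nullary.Negation.Core using (¬_)
open import Relation.Unary using (Decidable)
open import Algebra.Properties.CommutativeMonoid.Sum +-0-commutativeMonoid using (sum)

infixl 6 _[_]≔_

_[_]≔_ : ∀ {a} {A : Set a} {k} → Vector A k → Fin k → A → Vector A k
xs [ i ]≔ v = updateAt xs i (λ _ → v)

-- Parallel edges are allowed; loops are not.
record Graph (n m : ℕ) : Set where
  field
    ends     : Fin m → Fin n × Fin n
    loopless : ∀ e → proj₁ (ends e) ≢ proj₂ (ends e)
    c        : Fin m → ℕ

-- A cut (A , V ∖ A) is given by A; A and its complement denote the same cut,
-- and every notion below is symmetric under complementation.
IsCut : ∀ {n} → Subset n → Set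
IsCut A = Nonempty A × Nonempty (∁ A)

Splits : ∀ {n} → Subset n → Fin n → Fin n → Set
Splits A s t = (s ∈ A × t ∉ A) ⊎ (s ∉ A × t ∈ A)

splits? : ∀ {n} (A : Subset n) (s t : Fin n) → Dec (Splits A s t)
splits? A s t = ((s ∈? A) ×-dec ¬? (t ∈? A)) ⊎-dec (¬? (s ∈? A) ×-dec (t ∈? A))

module _ {n m : ℕ} (G : Graph n m) where

  open Graph G

  Joins : Fin m → Fin n → Fin n → Set
  Joins e x y = ends e ≡ (x , y) ⊎ ends e ≡ (y , x)

  weightOf : {P : Fin m → Set} → Decidable P → ℕ
  weightOf P? = sum (λ e → if does (P? e) then c e else 0)

  weight : Subset n → ℕ
  weight A = weightOf (λ e → splits? A (proj₁ (ends e)) (proj₂ (ends e)))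

  degree : Fin n → ℕ
  degree x = weightOf (λ e → (proj₁ (ends e) ≟ x) ⊎-dec (proj₂ (ends e) ≟ x))

  IsMinWeight : (Subset n → Set) → ℕ → Set
  IsMinWeight P k = (∃[ A ] P A × weight A ≡ k) × (∀ A → P A → k ℕ.≤ weight A)

  -- "k is the value of a minimum cut of G"
  MinCutValue : ℕ → Set
  MinCutValue = IsMinWeight IsCut

  -- "k = λ(G,s,t)"
  Connectivity : Fin n → Fin n → ℕ → Set
  Connectivity s t = IsMinWeight (λ A → IsCut A × Splits A s t)

-- The union-find structure is represented by its block labelling: u and v are
-- in the same block iff find u ≡ find v.
record Shared (n : ℕ) : Set where
  constructor shared
  field
    T    : Vector Bool n
    find : Vector (Fin n) n

unite : ∀ {n} → Fin n → Fin n → Vector (Fin n) n → Vector (Fin n) n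
unite x y find z = if does (find z ≟ find x) then find y else find z

SameBlock : ∀ {n} → Shared n → Fin n → Fin n → Set
SameBlock σ u v = Shared.find σ u ≡ Shared.find σ v

initShared : ∀ n → Shared n
initShared n = shared (λ _ → false) (λ v → v)

-- The program counter of a process.  The read of T x, the write to T x and
-- the treatment of each single edge are separate steps, so that steps of other
-- processes may occur in between.
data Control (n m : ℕ) : Set where
  ready  : Control n m
  test   : (x : Fin n) → Control n m
  claim  : (x : Fin n) → Control n m
  update : (x : Fin n) → Control n m
  -- S is the set of edges not yet treated in the current edge loop of x.
  scan   : (x : Fin n) (S : Subset m) → Control n m

record Local (n m : ℕ) : Set where
  field
    control : Control n m
    visited : Subset n
    B       : Subset n
    r       : Vector ℕ n
    q       : Vector ℕ m
    α       : ℤ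
    λ̂       : ℤ
    Q       : Vector (Maybe ℤ) n   -- Q v ≡ just p: v is queued with priority p

-- The start vertex is alone in the queue, so its initial priority is irrelevant.
initLocal : ∀ {n m} → ℤ → Fin n → Local n m
initLocal λ̂₀ s = record
  { control = ready
  ; visited = ⊥
  ; B       = ⊥
  ; r       = λ _ → 0
  ; q       = λ _ → 0
  ; α       = + 0
  ; λ̂       = λ̂₀
  ; Q       = (λ _ → nothing) [ s ]≔ just (+ 0)
  }

-- A performed operation union(x , y) for the edge e, together with the value
-- of λ̂ held at that moment by the process performing it.
record Union (n m : ℕ) : Set where
  constructor union
  field
    e     : Fin m
    x y   : Fin n
    bound : ℤ

module _ {n m : ℕ} (G : Graph n m) where

  open Graph G
  open Local

  HighestPriority : Local n m → Fin n → Set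
  HighestPriority ℓ x =
    ∃[ p ] Q ℓ x ≡ just p × (∀ y p′ → Q ℓ y ≡ just p′ → p′ ℤ.≤ p)

  -- For x being scanned, e is an edge (x , y) that the edge loop has to treat.
  Eligible : Local n m → Fin n → Fin m → Fin n → Set
  Eligible ℓ x e y = Joins G e x y × y ∉ B ℓ × y ∉ visited ℓ

  Contracts : Local n m → Fin m → Fin n → Set
  Contracts ℓ e y = + r ℓ y ℤ.< λ̂ ℓ × λ̂ ℓ ℤ.≤ + (r ℓ y ℕ.+ c e)

  pop : Fin n → Local n m → Local n m
  pop x ℓ = record ℓ
    { control = test x
    ; visited = visited ℓ ∪ ⁅ x ⁆
    ; Q       = Q ℓ [ x ]≔ nothing
    }

  blacklist : Fin n → Local n m → Local n m
  blacklist x ℓ = record ℓ { control = ready ; B = B ℓ ∪ ⁅ x ⁆ }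

  goto : Control n m → Local n m → Local n m
  goto k ℓ = record ℓ { control = k }

  updateBound : Fin n → Local n m → Local n m
  updateBound x ℓ = record ℓ { control = scan x ⊤ ; α = α′ ; λ̂ = λ̂ ℓ ⊓ α′ }
    where
    α′ : ℤ
    α′ = α ℓ ℤ.+ + degree G x ℤ.- + (2 ℕ.* r ℓ x)

  relax : Fin n → Subset m → Fin m → Fin n → Local n m → Local n m
  relax x S e y ℓ = record ℓ
    { control = scan x (S - e)
    ; r       = r ℓ [ y ]≔ r′
    ; q       = q ℓ [ e ]≔ r′
    ; Q       = Q ℓ [ y ]≔ just (+ r′ ⊓ λ̂ ℓ)
    }
    where
    r′ : ℕ
    r′ = r ℓ y ℕ.+ c e

  -- A single step of one process; the index of type List lists the union
  -- operation performed in this step, if any.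
  data LocalStep (ℓ : Local n m) : Shared n → List (Union n m) → Local n m → Shared n → Set where

    pops : ∀ {σ} x → control ℓ ≡ ready → HighestPriority ℓ x →
      LocalStep ℓ σ [] (pop x ℓ) σ

    readsTrue : ∀ {σ} x → control ℓ ≡ test x → Shared.T σ x ≡ true →
      LocalStep ℓ σ [] (blacklist x ℓ) σ

    readsFalse : ∀ {σ} x → control ℓ ≡ test x → Shared.T σ x ≡ false →
      LocalStep ℓ σ [] (goto (claim x) ℓ) σ

    writes : ∀ {T find} x → control ℓ ≡ claim x →
      LocalStep ℓ (shared T find) [] (goto (update x) ℓ) (shared (T [ x ]≔ true) find)

    updates : ∀ {σ} x → control ℓ ≡ update x →
      LocalStep ℓ σ [] (updateBound x ℓ) σ

    contracts : ∀ {T find} x S e y → control ℓ ≡ scan x S →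
      e ∈ S → Eligible ℓ x e y → Contracts ℓ e y →
      LocalStep ℓ (shared T find) (union e x y (λ̂ ℓ) ∷ [])
        (relax x S e y ℓ) (shared T (unite x y find))

    passes : ∀ {σ} x S e y → control ℓ ≡ scan x S →
      e ∈ S → Eligible ℓ x e y → ¬ Contracts ℓ e y →
      LocalStep ℓ σ [] (relax x S e y ℓ) σ

    finishes : ∀ {σ} x S → control ℓ ≡ scan x S →
      (∀ e y → e ∈ S → ¬ Eligible ℓ x e y) →
      LocalStep ℓ σ [] (goto ready ℓ) σ

  -- Execution λ̂₀ start us locals σ: some interleaving of the processes, begun
  -- with input bound λ̂₀ and start vertices start, leads to local states locals
  -- and shared state σ, having performed exactly the union operations us (most
  -- recent first).  It need not have terminated.
  data Execution {p : ℕ} (λ̂₀ : ℤ) (start : Fin p → Fin n) :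
    List (Union n m) → Vector (Local n m) p → Shared n → Set where

    begin : Execution λ̂₀ start [] (λ i → initLocal λ̂₀ (start i)) (initShared n)

    step : ∀ {us locals σ vs ℓ′ σ′} (i : Fin p) →
      Execution λ̂₀ start us locals σ →
      LocalStep (locals i) σ vs ℓ′ σ′ →
      Execution λ̂₀ start (vs ++ us) (locals [ i ]≔ ℓ′) σ′

{-# OPTIONS --safe #-}
module Submission where

-- The steps of the other processes only influence which popped vertices a process
-- blacklists, and a blacklisted vertex is simply never scanned.  The vertices that a
-- process does scan form a maximum adjacency order, with priorities capped at λ̂, so
-- the Stoer–Wagner argument applies to each process alone.  Fix a cut A.  Whenever an
-- unvisited vertex u lies on the other side of A than the vertex scanned last,
-- min (r u) λ̂ is at most the weight of the relaxed edges across A whose head is u or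
-- visited, hence at most the weight of A.  Lowering λ̂ only weakens this inequality,
-- whatever the values of λ̂ are.  If e = (x , y) is contracted, then A separating x
-- from y makes the inequality hold for y after e is relaxed, where its left-hand
-- side is λ̂.

open import Defs
open import Data.Bool.Base using (Bool; true; false; if_then_else_)
import Data.Bool.Properties as Bool
open import Data.Fin.Base using (Fin; zero; suc)
open import Data.Fin.Properties using (_≟_)
open import Data.Fin.Subset using (Subset; _∈_; _∉_; _⊆_; ∁; ⁅_⁆; _∪_; _-_; ⊤)
open import Data.Fin.Subset.Properties
  using ( _∈?_; anySubset?; nonempty?; ∉⊥; x∈⁅x⁆; x∈⁅y⁆⇒x≡y; x∉p⇒x∈∁p
        ; p⊆p∪q; q⊆p∪q; x∈p∪q⁻; x∈p∪q⁺; p─q⊆p)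
open import Data.Integer.Base using (ℤ; +_; _≤_; _<_; _+_; _⊓_; +≤+)
import Data.Integer.Properties as ℤ
open import Data.List.Base using (List)
open import Data.List.Relation.Unary.All using (All; []; _∷_)
import Data.List.Relation.Unary.All as All
open import Data.List.Relation.Unary.All.Properties using (++⁺)
open import Data.Maybe.Base using (Maybe; just; nothing)
open import Data.Maybe.Properties using (just-injective)
import Data.Maybe.Relation.Unary.Any as Maybe
open import Data.Nat.Base as ℕ using (ℕ; z≤n)
open import Data.Nat.Induction using (<-wellFounded)
import Data.Nat.Properties as ℕ
open import Data.Product.Base using (_×_; _,_; proj₁; proj₂; ∃-syntax)
open import Data.Sum.Base using (_⊎_; inj₁; inj₂; [_,_]′)
import Data.Sum.Base as Sum
open import Data.Vec.Base using (_∷_; there; lookup)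
open import Data.Vec.Functional using (Vector)
open import Data.Vec.Functional.Properties using (updateAt-updates; updateAt-minimal)
open import Data.Vec.Properties using ([]=⇒lookup; lookup⇒[]=)
open import Function.Base using (_∘_)
open import Induction.WellFounded using (Acc; acc)
open import Relation.Binary.PropositionalEquality.Core
  using (_≡_; _≢_; refl; sym; trans; cong; subst; subst₂)
open import Relation.Nullary.Decidable.Core using (Dec; yes; no; does; _×-dec_; decidable-stable)
open import Relation.Nullary.Negation.Core using (¬_; contradiction)
open import Relation.Unary using (Decidable)
open import Algebra.Properties.CommutativeMonoid.Sum ℕ.+-0-commutativeMonoid using (sum)
open import Algebra.Properties.CommutativeSemigroup ℕ.+-commutativeSemigroup using (xy∙z≈xz∙y)

-- Subsets, capped sums and weighted counts.

x∉p-x : ∀ {k} (p : Subset k) x → x ∉ p - x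
x∉p-x (_ ∷ p) (suc x) (there x∈p-x) = x∉p-x p x x∈p-x

∪-monoˡ : ∀ {k} {p q : Subset k} r → p ⊆ q → p ∪ r ⊆ q ∪ r
∪-monoˡ {p = p} r p⊆q = x∈p∪q⁺ ∘ Sum.map₁ p⊆q ∘ x∈p∪q⁻ p r

-- Relaxation adds `k` below the cap, while the crossing weight gains all of `k`; moving `k` outside
-- the cap can only increase the value.
[i+k]⊓j≤[i⊓j]+k : ∀ i j k → (i + + k) ⊓ j ≤ i ⊓ j + + k
[i+k]⊓j≤[i⊓j]+k i j k with ℤ.⊓-sel i j
... | inj₁ i⊓j≡i rewrite i⊓j≡i = ℤ.i⊓j≤i (i + + k) j
... | inj₂ i⊓j≡j rewrite i⊓j≡j = ℤ.≤-trans (ℤ.i⊓j≤j (i + + k) j) (ℤ.i≤i+j j (+ k))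

sum-mono : ∀ {k} {f g : Vector ℕ k} → (∀ i → f i ℕ.≤ g i) → sum f ℕ.≤ sum g
sum-mono {ℕ.zero}  f≤g = z≤n
sum-mono {ℕ.suc k} f≤g = ℕ.+-mono-≤ (f≤g zero) (sum-mono (f≤g ∘ suc))

sum-mono-gap : ∀ {k} {f g : Vector ℕ k} {d} i → (∀ j → f j ℕ.≤ g j) →
  f i ℕ.+ d ℕ.≤ g i → sum f ℕ.+ d ℕ.≤ sum g
sum-mono-gap {f = f} {g} {d} zero f≤g gap =
  subst (ℕ._≤ sum g) (xy∙z≈xz∙y (f zero) d (sum (f ∘ suc))) (ℕ.+-mono-≤ gap (sum-mono (f≤g ∘ suc)))
sum-mono-gap {f = f} {g} {d} (suc i) f≤g gap =
  subst (ℕ._≤ sum g) (sym (ℕ.+-assoc (f zero) (sum (f ∘ suc)) d))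
    (ℕ.+-mono-≤ (f≤g zero) (sum-mono-gap i (f≤g ∘ suc) gap))

if-does-mono : ∀ {P Q : Set} (P? : Dec P) (Q? : Dec Q) → (P → Q) → ∀ d →
  (if does P? then d else 0) ℕ.≤ (if does Q? then d else 0)
if-does-mono (yes p) (yes q) _   _ = ℕ.≤-refl
if-does-mono (yes p) (no ¬q) P⇒Q _ = contradiction (P⇒Q p) ¬q
if-does-mono (no _)  _       _   _ = z≤n

if-does-gap : ∀ {P Q : Set} (P? : Dec P) (Q? : Dec Q) → ¬ P → Q → ∀ d →
  (if does P? then d else 0) ℕ.+ d ℕ.≤ (if does Q? then d else 0)
if-does-gap (yes p) _       ¬p _ _ = contradiction p ¬p
if-does-gap (no _)  (yes _) _  _ _ = ℕ.≤-refl
if-does-gap (no _)  (no ¬q) _  q _ = contradiction q ¬q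

-- Sides of a cut.

-- Reading the side of a vertex as the Boolean `lookup A s` turns separation into an inequality, so
-- that being on one side can be chained by `trans`.
splits⇒lookup≢ : ∀ {n} {A : Subset n} {s t} → Splits A s t → lookup A s ≢ lookup A t
splits⇒lookup≢ {A = A} {s} {t} (inj₁ (s∈A , t∉A)) eq =
  t∉A (lookup⇒[]= t A (trans (sym eq) ([]=⇒lookup s∈A)))
splits⇒lookup≢ {A = A} {s} {t} (inj₂ (s∉A , t∈A)) eq =
  s∉A (lookup⇒[]= s A (trans eq ([]=⇒lookup t∈A)))

lookup≢⇒splits : ∀ {n} {A : Subset n} {s t} → lookup A s ≢ lookup A t → Splits A s t
lookup≢⇒splits {A = A} {s} {t} ≢ with s ∈? A | t ∈? A
... | yes s∈A | no t∉A  = inj₁ (s∈A , t∉A)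
... | no s∉A  | yes t∈A = inj₂ (s∉A , t∈A)
... | yes s∈A | yes t∈A = contradiction (trans ([]=⇒lookup s∈A) (sym ([]=⇒lookup t∈A))) ≢
... | no s∉A  | no t∉A  = contradiction (trans (outside′ s∉A) (sym (outside′ t∉A))) ≢
  where
  outside′ : ∀ {v} → v ∉ A → lookup A v ≡ false
  outside′ {v} v∉A = Bool.¬-not (v∉A ∘ lookup⇒[]= v A)

¬splits⇒lookup≡ : ∀ {n} {A : Subset n} {s t} → ¬ Splits A s t → lookup A s ≡ lookup A t
¬splits⇒lookup≡ ¬split = decidable-stable (_ Bool.≟ _) (¬split ∘ lookup≢⇒splits)

splits⇒isCut : ∀ {n} {A : Subset n} {s t} → Splits A s t → IsCut A
splits⇒isCut (inj₁ (s∈A , t∉A)) = (_ , s∈A) , (_ , x∉p⇒x∈∁p t∉A)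
splits⇒isCut (inj₂ (s∉A , t∈A)) = (_ , t∈A) , (_ , x∉p⇒x∈∁p s∉A)

splits-singleton : ∀ {n} {s t : Fin n} → s ≢ t → Splits ⁅ s ⁆ s t
splits-singleton {s = s} s≢t = inj₁ (x∈⁅x⁆ s , s≢t ∘ sym ∘ x∈⁅y⁆⇒x≡y s)

module _ {n m : ℕ} (G : Graph n m) where

  open Graph G
  open Local

  -- Edges, weights and existence of minimum cuts.

  joins⇒≢ : ∀ {e x y} → Joins G e x y → x ≢ y
  joins⇒≢ {e} (inj₁ eq) refl = loopless e (trans (cong proj₁ eq) (sym (cong proj₂ eq)))
  joins⇒≢ {e} (inj₂ eq) refl = loopless e (trans (cong proj₁ eq) (sym (cong proj₂ eq)))

  joins-determines : ∀ {e x y u v} → Joins G e x y → Joins G e u v → x ≡ u ⊎ x ≡ v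
  joins-determines (inj₁ p) (inj₁ q) = inj₁ (cong proj₁ (trans (sym p) q))
  joins-determines (inj₁ p) (inj₂ q) = inj₂ (cong proj₁ (trans (sym p) q))
  joins-determines (inj₂ p) (inj₁ q) = inj₂ (cong proj₂ (trans (sym p) q))
  joins-determines (inj₂ p) (inj₂ q) = inj₁ (cong proj₂ (trans (sym p) q))

  weightOf-mono : {P Q : Fin m → Set} (P? : Decidable P) (Q? : Decidable Q) →
    (∀ e → P e → Q e) → weightOf G P? ℕ.≤ weightOf G Q?
  weightOf-mono P? Q? P⇒Q = sum-mono λ e → if-does-mono (P? e) (Q? e) (P⇒Q e) (c e)

  weightOf-gap : {P Q : Fin m → Set} (P? : Decidable P) (Q? : Decidable Q) →
    (∀ e → P e → Q e) → ∀ e → ¬ P e → Q e → weightOf G P? ℕ.+ c e ℕ.≤ weightOf G Q?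
  weightOf-gap P? Q? P⇒Q e ¬Pe Qe =
    sum-mono-gap e (λ j → if-does-mono (P? j) (Q? j) (P⇒Q j) (c j))
      (if-does-gap (P? e) (Q? e) ¬Pe Qe (c e))

  -- Descent on the weight: since there are finitely many subsets, a lighter one satisfying `P` is
  -- either found, and the search restarts from it, or excluded.
  minWeight-exists : {P : Subset n → Set} → Decidable P → ∀ A → P A → ∃[ k ] IsMinWeight G P k
  minWeight-exists {P} P? A = go A (<-wellFounded (weight G A))
    where
    go : ∀ A → Acc ℕ._<_ (weight G A) → P A → ∃[ k ] IsMinWeight G P k
    go A (acc rec) PA with anySubset? (λ A′ → P? A′ ×-dec (weight G A′ ℕ.<? weight G A))
    ... | yes (A′ , PA′ , lighter) = go A′ (rec lighter) PA′
    ... | no none = weight G A , (A , PA , refl) , λ A′ PA′ → ℕ.≮⇒≥ λ lighter → none (A′ , PA′ , lighter)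

  connectivity-exists : ∀ {s t} → s ≢ t → ∃[ k ] Connectivity G s t k
  connectivity-exists {s} {t} s≢t =
    minWeight-exists (λ A → (nonempty? A ×-dec nonempty? (∁ A)) ×-dec splits? A s t)
      ⁅ s ⁆ (splits⇒isCut split , split)
    where split = splits-singleton s≢t

  -- Keys computed with an older, larger λ̂ are only correct after capping with the current one.
  Queued : Local n m → Fin n → Set
  Queued ℓ u = (Q ℓ u ≡ nothing × r ℓ u ≡ 0) ⊎ (∃[ p ] Q ℓ u ≡ just p × p ⊓ λ̂ ℓ ≡ + r ℓ u ⊓ λ̂ ℓ)

  -- Relaxed weight across a fixed cut.

  module _ (A : Subset n) where

    -- h e ≡ just y means that the process has relaxed e towards y.
    CrossesInto : (h : Vector (Maybe (Fin n)) m) → Subset n → Fin m → Set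
    CrossesInto h X e = Splits A (proj₁ (ends e)) (proj₂ (ends e)) × Maybe.Any (_∈ X) (h e)

    crossesInto? : ∀ h X → Decidable (CrossesInto h X)
    crossesInto? h X e = splits? A (proj₁ (ends e)) (proj₂ (ends e)) ×-dec Maybe.dec (_∈? X) (h e)

    crossing : Vector (Maybe (Fin n)) m → Subset n → ℕ
    crossing h X = weightOf G (crossesInto? h X)

    crossing≤weight : ∀ h X → crossing h X ℕ.≤ weight G A
    crossing≤weight h X =
      weightOf-mono (crossesInto? h X) (λ e → splits? A (proj₁ (ends e)) (proj₂ (ends e))) λ _ → proj₁

    crossing-mono : ∀ h {X Y} → X ⊆ Y → + crossing h X ≤ + crossing h Y
    crossing-mono h {X} {Y} X⊆Y =
      +≤+ (weightOf-mono (crossesInto? h X) (crossesInto? h Y) λ _ (split , into) → split , Maybe.map X⊆Y into)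

    joins∧lookup≢⇒splits : ∀ {e x y} → Joins G e x y → lookup A y ≢ lookup A x →
      Splits A (proj₁ (ends e)) (proj₂ (ends e))
    joins∧lookup≢⇒splits (inj₁ eq) ≢ rewrite eq = lookup≢⇒splits (≢ ∘ sym)
    joins∧lookup≢⇒splits (inj₂ eq) ≢ rewrite eq = lookup≢⇒splits ≢

    -- An edge without a direction counts nowhere, so giving it one cannot remove any edge from the
    -- count.
    crossesInto-direct : ∀ {h e} → h e ≡ nothing → ∀ y X e′ →
      CrossesInto h X e′ → CrossesInto (h [ e ]≔ just y) X e′
    crossesInto-direct {h} {e} he≡nothing y X e′ (split , into) with e′ ≟ e
    ... | no e′≢e = split , subst (Maybe.Any (_∈ X)) (sym (updateAt-minimal e′ e h e′≢e)) into
    ... | yes refl with () ← subst (Maybe.Any (_∈ X)) he≡nothing into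

    crossing-direct : ∀ h {e} → h e ≡ nothing → ∀ y X →
      + crossing h X ≤ + crossing (h [ e ]≔ just y) X
    crossing-direct h he≡nothing y X =
      +≤+ (weightOf-mono (crossesInto? h X) (crossesInto? _ X) (crossesInto-direct he≡nothing y X))

    -- The edge `e` contributes nothing before it is directed and its full weight afterwards,
    -- because its head `y` lies in `X` and across the cut from `x`.
    crossing-direct-gap : ∀ h {e x y} X → h e ≡ nothing → Joins G e x y → lookup A y ≢ lookup A x → y ∈ X →
      + crossing h X + + c e ≤ + crossing (h [ e ]≔ just y) X
    crossing-direct-gap h {e} {x} {y} X he≡nothing joins ≢ y∈X =
      +≤+ (weightOf-gap (crossesInto? h X) (crossesInto? (h [ e ]≔ just y) X)
        (crossesInto-direct he≡nothing y X) e ¬into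
        (joins∧lookup≢⇒splits joins ≢ , subst (Maybe.Any (_∈ X)) (sym (updateAt-updates e h)) (Maybe.just y∈X)))
      where
      ¬into : ¬ CrossesInto h X e
      ¬into (_ , into) with () ← subst (Maybe.Any (_∈ X)) he≡nothing into

    -- The invariant of a single process.

    module _ (h : Vector (Maybe (Fin n)) m) (ℓ : Local n m) where

      -- b will be the side of the vertex scanned last.
      BoundedOff : Bool → Set
      BoundedOff b = ∀ u → u ∉ visited ℓ → lookup A u ≢ b →
        + r ℓ u ⊓ λ̂ ℓ ≤ + crossing h (visited ℓ ∪ ⁅ u ⁆)

      -- `untreated` guarantees that relaxing an edge of `S` counts it for the first time. It is
      -- confined to unvisited `y`, since an edge from a visited `y` may already have been relaxed
      -- towards `x`.
      record Scanning (x : Fin n) (S : Subset m) : Set where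
        field
          x∈visited : x ∈ visited ℓ
          bounded   : BoundedOff (lookup A x)
          untreated : ∀ e y → e ∈ S → Joins G e x y → y ∉ visited ℓ → h e ≡ nothing

      -- At `test x` it is still open whether `x` will be scanned. The bound for the previous side
      -- `b` is kept for the case that `x` is blacklisted, and `Scanning` for the case that it is
      -- claimed.
      Phase : Control n m → Set
      Phase ready      = ∃[ b ] BoundedOff b
      Phase (test x)   = (∃[ b ] BoundedOff b) × Scanning x ⊤
      Phase (claim x)  = Scanning x ⊤
      Phase (update x) = Scanning x ⊤
      Phase (scan x S) = Scanning x S

      record Invariant : Set where
        field
          queue-unvisited : ∀ u p → Q ℓ u ≡ just p → u ∉ visited ℓ
          queued          : ∀ u → u ∉ visited ℓ → Queued ℓ u
          unrelaxed       : ∀ e x y → Joins G e x y → x ∉ visited ℓ → y ∉ visited ℓ → h e ≡ nothing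
          phase           : Phase (control ℓ)

    -- Preservation of the invariant.

    open Invariant
    open Scanning

    initInvariant : ∀ λ̂₀ s → Invariant (λ _ → nothing) (initLocal λ̂₀ s)
    initInvariant λ̂₀ s = record
      { queue-unvisited = λ _ _ _ → ∉⊥
      ; queued          = λ u _ → queued₀ u
      ; unrelaxed       = λ _ _ _ _ _ _ → refl
      -- Either side would do: all `r` are 0, so every left-hand side is at most 0.
      ; phase           = true , λ u _ _ → ℤ.≤-trans (ℤ.i⊓j≤i (+ 0) λ̂₀) (+≤+ z≤n)
      }
      where
      queued₀ : ∀ u → Queued (initLocal λ̂₀ s) u
      queued₀ u with u ≟ s
      ... | yes refl = inj₂ (+ 0 , updateAt-updates s _ , refl)
      ... | no u≢s   = inj₁ (updateAt-minimal u s _ u≢s , refl)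

    goto-scanning : ∀ {h ℓ x S} k → Scanning h ℓ x S → Scanning h (goto G k ℓ) x S
    goto-scanning k sc = record
      { x∈visited = x∈visited sc
      ; bounded   = bounded sc
      ; untreated = untreated sc
      }

    goto-invariant : ∀ {h ℓ} k → Invariant h ℓ → Phase h (goto G k ℓ) k → Invariant h (goto G k ℓ)
    goto-invariant k inv ph = record
      { queue-unvisited = queue-unvisited inv
      ; queued          = queued inv
      ; unrelaxed       = unrelaxed inv
      ; phase           = ph
      }

    -- Keys may be stale, so their order is transferred to `r` only after capping both with the
    -- current `λ̂`. An unvisited vertex outside the queue has `r` equal to 0.
    highest-capped : ∀ {h ℓ x} → Invariant h ℓ → HighestPriority G ℓ x → ∀ u → u ∉ visited ℓ →
      + r ℓ u ⊓ λ̂ ℓ ≤ + r ℓ x ⊓ λ̂ ℓ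
    highest-capped {h} {ℓ} {x} inv (p , Qx≡p , highest) u u∉
      with queued inv u u∉ | queued inv x (queue-unvisited inv x p Qx≡p)
    ... | _ | inj₁ (Qx≡nothing , _) with () ← trans (sym Qx≡p) Qx≡nothing
    ... | inj₁ (_ , ru≡0) | inj₂ _ rewrite ru≡0 = ℤ.⊓-monoˡ-≤ (λ̂ ℓ) (+≤+ z≤n)
    ... | inj₂ (p′ , Qu≡p′ , capped-u) | inj₂ (p″ , Qx≡p″ , capped-x) =
      subst₂ _≤_ capped-u
        (trans (cong (_⊓ λ̂ ℓ) (just-injective (trans (sym Qx≡p) Qx≡p″))) capped-x)
        (ℤ.⊓-monoˡ-≤ (λ̂ ℓ) (highest u p′ Qu≡p′))

    pop-invariant : ∀ {h ℓ} x → Invariant h ℓ → ∃[ b ] BoundedOff h ℓ b → HighestPriority G ℓ x →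
      Invariant h (pop G x ℓ)
    pop-invariant {h} {ℓ} x inv (b , bounded-b) hp@(p , Qx≡p , _) = record
      { queue-unvisited = queue-unvisited′
      ; queued          = queued′
      ; unrelaxed       = λ e y z joins y∉ z∉ → unrelaxed inv e y z joins (y∉ ∘ old) (z∉ ∘ old)
      ; phase           = (b , bounded-b′) , record
        { x∈visited = q⊆p∪q V ⁅ x ⁆ (x∈⁅x⁆ x)
        ; bounded   = bounded-x
        -- Before the pop both ends of such an edge were unvisited, so `unrelaxed` applies.
        ; untreated = λ e y _ joins y∉ → unrelaxed inv e x y joins x∉V (y∉ ∘ old)
        }
      }
      where
      V = visited ℓ

      old : V ⊆ V ∪ ⁅ x ⁆
      old = p⊆p∪q ⁅ x ⁆

      x∉V : x ∉ V
      x∉V = queue-unvisited inv x p Qx≡p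

      ≢x : ∀ {u} → u ∉ V ∪ ⁅ x ⁆ → u ≢ x
      ≢x u∉ refl = u∉ (q⊆p∪q V ⁅ x ⁆ (x∈⁅x⁆ x))

      queue-unvisited′ : ∀ u p′ → Q (pop G x ℓ) u ≡ just p′ → u ∉ V ∪ ⁅ x ⁆
      queue-unvisited′ u p′ Qu≡p′ u∈ with u ≟ x
      ... | yes refl with () ← trans (sym (updateAt-updates x (Q ℓ))) Qu≡p′
      ... | no u≢x = [ queue-unvisited inv u p′ (trans (sym (updateAt-minimal u x (Q ℓ) u≢x)) Qu≡p′)
                     , u≢x ∘ x∈⁅y⁆⇒x≡y x ]′ (x∈p∪q⁻ V ⁅ x ⁆ u∈)

      queued′ : ∀ u → u ∉ V ∪ ⁅ x ⁆ → Queued (pop G x ℓ) u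
      queued′ u u∉ rewrite updateAt-minimal u x {λ _ → nothing} (Q ℓ) (≢x u∉) = queued inv u (u∉ ∘ old)

      bounded-b′ : BoundedOff h (pop G x ℓ) b
      bounded-b′ u u∉ ≢b = ℤ.≤-trans (bounded-b u (u∉ ∘ old) ≢b) (crossing-mono h (∪-monoˡ ⁅ u ⁆ old))

      -- If x lies on the side b, the old inequality for u suffices.  Otherwise x
      -- satisfies it, and u inherits it because x has the highest priority.
      bounded-x : BoundedOff h (pop G x ℓ) (lookup A x)
      bounded-x u u∉ ≢x with lookup A x Bool.≟ b
      ... | yes refl = bounded-b′ u u∉ ≢x
      ... | no x≢b   = ℤ.≤-trans (highest-capped inv hp u (u∉ ∘ old))
        (ℤ.≤-trans (bounded-b x x∉V x≢b) (crossing-mono h (p⊆p∪q ⁅ u ⁆)))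

    -- The new bound is the old one capped by `a`: capping both sides once more preserves the
    -- equalities in `Queued`, and the left-hand sides in `BoundedOff` can only drop.
    updateBound-invariant : ∀ {h ℓ} x → Invariant h ℓ → Scanning h ℓ x ⊤ → Invariant h (updateBound G x ℓ)
    updateBound-invariant {h} {ℓ} x inv sc = record
      { queue-unvisited = queue-unvisited inv
      ; queued          = λ u u∉ →
          Sum.map₂ (λ (p , Qu≡p , capped) → p , Qu≡p , recap p (+ r ℓ u) capped) (queued inv u u∉)
      ; unrelaxed       = unrelaxed inv
      ; phase           = record
        { x∈visited = x∈visited sc
        ; bounded   = λ u u∉ ≢x → ℤ.≤-trans (ℤ.⊓-monoʳ-≤ (+ r ℓ u) (ℤ.i⊓j≤i (λ̂ ℓ) a)) (bounded sc u u∉ ≢x)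
        ; untreated = untreated sc
        }
      }
      where
      a = α (updateBound G x ℓ)

      recap : ∀ i j → i ⊓ λ̂ ℓ ≡ j ⊓ λ̂ ℓ → i ⊓ (λ̂ ℓ ⊓ a) ≡ j ⊓ (λ̂ ℓ ⊓ a)
      recap i j eq = trans (sym (ℤ.⊓-assoc i (λ̂ ℓ) a)) (trans (cong (_⊓ a) eq) (ℤ.⊓-assoc j (λ̂ ℓ) a))

    -- For `u` other than `y`, `r u` is unchanged and the crossing weight does not drop. For `y`
    -- itself, `r y` grows by `c e`, and so does the crossing weight, as `e` crosses the cut and is
    -- newly counted.
    relax-bounded : ∀ {h ℓ x S e y} → Scanning h ℓ x S → e ∈ S → Joins G e x y → y ∉ visited ℓ →
      BoundedOff (h [ e ]≔ just y) (relax G x S e y ℓ) (lookup A x)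
    relax-bounded {h} {ℓ} {x} {S} {e} {y} sc e∈S joins y∉ u u∉ u≢x with u ≟ y
    ... | no u≢y rewrite updateAt-minimal u y {λ _ → r ℓ y ℕ.+ c e} (r ℓ) u≢y =
      ℤ.≤-trans (bounded sc u u∉ u≢x) (crossing-direct h (untreated sc e y e∈S joins y∉) y _)
    ... | yes refl rewrite updateAt-updates y {λ _ → r ℓ y ℕ.+ c e} (r ℓ) = chain
      (+ r ℓ y + + c e) ⊓ λ̂ ℓ         ≤⟨ [i+k]⊓j≤[i⊓j]+k (+ r ℓ y) (λ̂ ℓ) (c e) ⟩
      (+ r ℓ y ⊓ λ̂ ℓ) + + c e         ≤⟨ ℤ.+-monoˡ-≤ (+ c e) (bounded sc y y∉ u≢x) ⟩
      + crossing h Y + + c e           ≤⟨ crossing-direct-gap h Y (untreated sc e y e∈S joins y∉) joins u≢x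
                                            (q⊆p∪q (visited ℓ) ⁅ y ⁆ (x∈⁅x⁆ y)) ⟩
      + crossing (h [ e ]≔ just y) Y   ∎
      where
      open ℤ.≤-Reasoning renaming (begin_ to chain_)
      Y = visited ℓ ∪ ⁅ y ⁆

    relax-invariant : ∀ {h ℓ x S e y} → Invariant h ℓ → Scanning h ℓ x S → e ∈ S → Eligible G ℓ x e y →
      Invariant (h [ e ]≔ just y) (relax G x S e y ℓ)
    relax-invariant {h} {ℓ} {x} {S} {e} {y} inv sc e∈S (joins , _ , y∉) = record
      { queue-unvisited = queue-unvisited′
      ; queued          = queued′
      ; unrelaxed       = unrelaxed′
      ; phase           = record
        { x∈visited = x∈visited sc
        ; bounded   = relax-bounded sc e∈S joins y∉
        ; untreated = λ e′ z e′∈ joins′ z∉ →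
            trans (updateAt-minimal e′ e h λ { refl → x∉p-x S e e′∈ })
              (untreated sc e′ z (p─q⊆p S ⁅ e ⁆ e′∈) joins′ z∉)
        }
      }
      where
      ℓ′ = relax G x S e y ℓ

      queue-unvisited′ : ∀ u p → Q ℓ′ u ≡ just p → u ∉ visited ℓ
      queue-unvisited′ u p Qu≡p with u ≟ y
      ... | yes refl = y∉
      ... | no u≢y   = queue-unvisited inv u p (trans (sym (updateAt-minimal u y (Q ℓ) u≢y)) Qu≡p)

      queued′ : ∀ u → u ∉ visited ℓ → Queued ℓ′ u
      queued′ u u∉ with u ≟ y
      ... | yes refl rewrite updateAt-updates y {λ _ → r ℓ y ℕ.+ c e} (r ℓ) =
        inj₂ (_ , updateAt-updates y (Q ℓ) ,
          trans (ℤ.⊓-assoc (+ (r ℓ y ℕ.+ c e)) _ _) (cong (+ (r ℓ y ℕ.+ c e) ⊓_) (ℤ.⊓-idem (λ̂ ℓ))))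
      ... | no u≢y
        rewrite updateAt-minimal u y {λ _ → r ℓ y ℕ.+ c e} (r ℓ) u≢y
              | updateAt-minimal u y {λ _ → just (+ (r ℓ y ℕ.+ c e) ⊓ λ̂ ℓ)} (Q ℓ) u≢y = queued inv u u∉

      unrelaxed′ : ∀ e′ v w → Joins G e′ v w → v ∉ visited ℓ → w ∉ visited ℓ → (h [ e ]≔ just y) e′ ≡ nothing
      unrelaxed′ e′ v w joins′ v∉ w∉ with e′ ≟ e
      ... | no e′≢e  = trans (updateAt-minimal e′ e h e′≢e) (unrelaxed inv e′ v w joins′ v∉ w∉)
      -- The edge just relaxed has the visited end `x`, so it cannot have two unvisited ends.
      ... | yes refl = contradiction (x∈visited sc)
        ([ (λ { refl → v∉ }) , (λ { refl → w∉ }) ]′ (joins-determines joins joins′))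

    phase-at : ∀ {h ℓ k} → Invariant h ℓ → control ℓ ≡ k → Phase h ℓ k
    phase-at {h} {ℓ} inv eq = subst (Phase h ℓ) eq (phase inv)

    localStep-invariant : ∀ {ℓ σ us ℓ′ σ′} → LocalStep G ℓ σ us ℓ′ σ′ →
      ∃[ h ] Invariant h ℓ → ∃[ h ] Invariant h ℓ′
    localStep-invariant (pops x eq hp) (h , inv) = h , pop-invariant x inv (phase-at inv eq) hp
    localStep-invariant (readsTrue x eq _) (h , inv) = h , record
      { queue-unvisited = queue-unvisited inv
      ; queued          = queued inv
      ; unrelaxed       = unrelaxed inv
      -- A blacklisted `x` is not scanned, so the side `b` of the earlier bound stays in force.
      ; phase           = proj₁ (phase-at inv eq)
      }
    localStep-invariant (readsFalse x eq _) (h , inv) =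
      h , goto-invariant (claim x) inv (goto-scanning _ (proj₂ (phase-at inv eq)))
    localStep-invariant (writes x eq) (h , inv) =
      h , goto-invariant (update x) inv (goto-scanning _ (phase-at inv eq))
    localStep-invariant (updates x eq) (h , inv) = h , updateBound-invariant x inv (phase-at inv eq)
    localStep-invariant (contracts x S e y eq e∈S el _) (h , inv) =
      _ , relax-invariant inv (phase-at inv eq) e∈S el
    localStep-invariant (passes x S e y eq e∈S el _) (h , inv) =
      _ , relax-invariant inv (phase-at inv eq) e∈S el
    -- Now `x` is the vertex scanned last, and its side becomes the new `b`.
    localStep-invariant (finishes x S eq _) (h , inv) =
      h , goto-invariant ready inv (lookup A x , bounded (phase-at inv eq))

    execution-invariant : ∀ {p λ̂₀ start us locals σ} → Execution G {p} λ̂₀ start us locals σ →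
      ∀ i → ∃[ h ] Invariant h (locals i)
    execution-invariant {λ̂₀ = λ̂₀} {start} begin i = _ , initInvariant λ̂₀ (start i)
    execution-invariant (step {locals = locals} {ℓ′ = ℓ′} j ex ls) i with i ≟ j
    ... | yes refl rewrite updateAt-updates j {λ _ → ℓ′} locals = localStep-invariant ls (execution-invariant ex j)
    ... | no i≢j rewrite updateAt-minimal i j {λ _ → ℓ′} locals i≢j = execution-invariant ex i

    -- The bound for `y` is read off in the state just after the relaxation, which leaves `λ̂` as it
    -- was; the contraction test makes the cap there take the value `λ̂`.
    contracts-bound : ∀ {h ℓ x S e y} → Scanning h ℓ x S → e ∈ S → Eligible G ℓ x e y → Contracts G ℓ e y →
      Splits A x y → λ̂ ℓ ≤ + weight G A
    contracts-bound {h} {ℓ} {x} {S} {e} {y} sc e∈S (joins , _ , y∉) (_ , λ̂≤r′) split = chain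
      λ̂ ℓ                                         ≡⟨ ℤ.i≥j⇒i⊓j≡j λ̂≤r′ ⟨
      + (r ℓ y ℕ.+ c e) ⊓ λ̂ ℓ                     ≡⟨ cong (λ k → + k ⊓ λ̂ ℓ) (updateAt-updates y (r ℓ)) ⟨
      + r (relax G x S e y ℓ) y ⊓ λ̂ ℓ             ≤⟨ relax-bounded sc e∈S joins y∉ y y∉ (splits⇒lookup≢ split ∘ sym) ⟩
      + crossing (h [ e ]≔ just y) _              ≤⟨ +≤+ (crossing≤weight (h [ e ]≔ just y) (visited ℓ ∪ ⁅ y ⁆)) ⟩
      + weight G A                                ∎
      where open ℤ.≤-Reasoning renaming (begin_ to chain_)

  -- From cut bounds to connectivity.

  -- Distinctness of the ends ensures that some cut separates them, so that their connectivity
  -- exists.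
  BoundsCuts : Union n m → Set
  BoundsCuts u = Union.x u ≢ Union.y u × (∀ A → Splits A (Union.x u) (Union.y u) → Union.bound u ≤ + weight G A)

  execution-boundsCuts : ∀ {p λ̂₀ start us locals σ} → Execution G {p} λ̂₀ start us locals σ → All BoundsCuts us
  execution-boundsCuts begin = []
  execution-boundsCuts (step i ex ls) = ++⁺ (new ls) (execution-boundsCuts ex)
    where
    new : ∀ {vs ℓ′ σ′} → LocalStep G _ _ vs ℓ′ σ′ → All BoundsCuts vs
    new (pops _ _ _)         = []
    new (readsTrue _ _ _)    = []
    new (readsFalse _ _ _)   = []
    new (writes _ _)         = []
    new (updates _ _)        = []
    new (contracts x S e y eq e∈S el con) =
      (joins⇒≢ (proj₁ el) , λ A split →
        -- The invariant is taken for this `A` in the state right before the union.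
        contracts-bound A (phase-at A (proj₂ (execution-invariant A ex i)) eq) e∈S el con split) ∷ []
    new (passes _ _ _ _ _ _ _ _) = []
    new (finishes _ _ _ _)   = []

  boundsCuts⇒connectivity : ∀ u → BoundsCuts u →
    ∃[ k ] (Connectivity G (Union.x u) (Union.y u) k × Union.bound u ≤ + k)
  boundsCuts⇒connectivity _ (x≢y , bounds) with connectivity-exists x≢y
  -- The bound is applied to a separating cut `A` that attains the minimum.
  ... | _ , conn@((A , (_ , split) , refl) , _) = _ , conn , bounds A split

  -- Union-find blocks and sides of a cut.

  -- Equivalently, `A` is a union of blocks.
  RespectsFind : Subset n → Vector (Fin n) n → Set
  RespectsFind A find = ∀ s t → find s ≡ find t → lookup A s ≡ lookup A t

  unite-respects : ∀ {A x y find} → lookup A x ≡ lookup A y → RespectsFind A find → RespectsFind A (unite x y find)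
  unite-respects {x = x} {y} {find} x~y resp s t eq with find s ≟ find x | find t ≟ find x
  ... | yes s~x | yes t~x = resp s t (trans s~x (sym t~x))
  -- The new label of `s` is `find y`, so `eq` places `t` in the old block of `y`.
  ... | yes s~x | no _    = trans (resp s x s~x) (trans x~y (resp y t eq))
  ... | no _    | yes t~x = trans (resp s y eq) (sym (trans (resp t x t~x) x~y))
  ... | no _    | no _    = resp s t eq

  execution-respects : ∀ {p λ̂₀ start us locals σ} → Execution G {p} λ̂₀ start us locals σ → ∀ A →
    All (λ u → lookup A (Union.x u) ≡ lookup A (Union.y u)) us → RespectsFind A (Shared.find σ)
  execution-respects begin A _ s t s≡t = cong (lookup A) s≡t
  execution-respects (step i ex (pops _ _ _)) A        = execution-respects ex A
  execution-respects (step i ex (readsTrue _ _ _)) A   = execution-respects ex A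
  execution-respects (step i ex (readsFalse _ _ _)) A  = execution-respects ex A
  execution-respects (step i ex (writes _ _)) A        = execution-respects ex A
  execution-respects (step i ex (updates _ _)) A       = execution-respects ex A
  execution-respects (step i ex (contracts _ _ _ _ _ _ _ _)) A (x~y ∷ rest) =
    unite-respects {A = A} x~y (execution-respects ex A rest)
  execution-respects (step i ex (passes _ _ _ _ _ _ _ _)) A = execution-respects ex A
  execution-respects (step i ex (finishes _ _ _ _)) A  = execution-respects ex A

theorem3p1 : ∀ {n m : ℕ} (G : Graph n m) (λ̂₀ : ℤ) →
    (∀ μ → MinCutValue G μ → + μ ≤ λ̂₀) →
    ∀ {p : ℕ} (start : Fin p → Fin n)
    {us : List (Union n m)} {locals : Vector (Local n m) p} {σ : Shared n} →
    Execution G λ̂₀ start us locals σ →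
    All (λ u → ∃[ k ] (Connectivity G (Union.x u) (Union.y u) k × Union.bound u ≤ + k)) us
    × (∀ s t → SameBlock σ s t → ∀ (A : Subset n) → IsCut A →
    All (λ u → + weight G A < Union.bound u) us → ¬ Splits A s t)
theorem3p1 G λ̂₀ _ start ex =
  All.map (λ {u} → boundsCuts⇒connectivity G u) boundsCuts ,
  λ s t same A _ lighter split →
    splits⇒lookup≢ split
      (execution-respects G ex A
        -- A cut lighter than the bound of a union cannot separate its two ends, so every performed
        -- union stays on one side of `A`.
        (All.zipWith
          (λ ((_ , bounds) , light) → ¬splits⇒lookup≡ (λ split′ → ℤ.≤⇒≯ (bounds A split′) light))
          (boundsCuts , lighter))
        s t same)
  where boundsCuts = execution-boundsCuts G ex
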